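{- Let $\mathbf{RB}=\langle RB,\land,\lor,\neg,0,1\rangle$ be a weak relativized Boolean algebra. Then: (1) For each $X\in RB$, the set $\pi_1(X)=\{Z\in RB \mid 1_Z=1_X\}$ is a Boolean algebra, with $1_X$ and $0_X$ as the top and bottom elements and with the operations inherited from $\mathbf{RB}$. (2) $\mathbf{RB}$ is a relativized Boolean algebra (that is, it satisfies: $X\geq Y$ implies $\neg(X\land 1_Y)=\neg X\land 1_Y$) if and only if for all $X\geq Y$ in $RB$ the map $h^X_Y: Z\mapsto Z\land 1_Y$ is a homomorphism from $\pi_1(X)$ to $\pi_1(Y)$. Moreover, in such cases, if $X\geq Y\geq Z$ then $h^Y_Z\circ h^X_Y=h^X_Z$.
   Context: An algebra of Boolean similarity type is $\mathbf{A}=\langle A,\land,\lor,\neg,0,1\rangle$ with $A$ a set, $0,1\in A$, $\land,\lor$ binary operations on $A$ and $\neg$ a unary operation on $A$. A homomorphism between algebras of Boolean similarity type is a function $h$ with $h(1)=1'$ that respects $\land,\lor,\neg$ (preservation of $0$ is not part of the definition). For such an algebra write $1_X:=X\lor\neg X$, $0_X:=X\land\neg X$, and $Y\geq X$ iff $X\land Y=X$. A weak relativized Boolean algebra is an algebra of Boolean similarity type satisfying, for all elements $X$: (RB1) $\land$ and $\lor$ are associative, commutative, distributive (each over the other), and with $\neg$ satisfy De Morgan's laws; (RB2) $X\land X=X\lor X=X\land 1=\neg\neg X=X$; (RB3) $X\lor 1=1_X$; (RB4) $X\land 0=0$. A relativized Boolean algebra is a weak relativized Boolean algebra that also satisfies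 (RB5) $X\geq Y$ implies $\neg(X\land 1_Y)=\neg X\land 1_Y$. A Boolean algebra is an algebra of Boolean similarity type in which $\land,\lor$ are associative, commutative and distributive, and $X\lor\neg X=1$, $X\land\neg X=0$, $X\lor 0=X\land 1=X$ for all $X$ (the case $0=1$ is not excluded). In part (2), $\pi_1(X)$ is regarded as an algebra with top element $1_X$ and bottom element $0_X$. -}

module Defs where

open import Algebra.Core using (Op₁; Op₂)
open import Algebra.Lattice.Bundles using (RawLattice)
open import Algebra.Lattice.Morphism.Structures using (module LatticeMorphisms)
import Algebra.Definitions as AlgebraDefinitions
import Algebra.Lattice.Structures as LatticeStructures
open import Data.Product using (Σ; _,_; proj₁; Σ-syntax)
open import Function using (_on_)
open import Level using (Level; suc; _⊔_)
open import Relation.Binary using (Rel; IsEquivalence)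
open import Relation.Unary using (Pred; _∈_)

private
  variable
    c c₁ c₂ ℓ ℓ₁ ℓ₂ p : Level

-- Algebras of Boolean similarity type, over a setoid as in Algebra.*:
-- equality of elements is _≈_.
record RawBooleanAlgebra c ℓ : Set (suc (c ⊔ ℓ)) where
  infix  8 ¬_
  infixr 7 _∧_
  infixr 6 _∨_
  infix  4 _≈_ _≥_
  field
    Carrier : Set c
    _≈_     : Rel Carrier ℓ
    _∧_     : Op₂ Carrier
    _∨_     : Op₂ Carrier
    ¬_      : Op₁ Carrier
    𝟘       : Carrier
    𝟙       : Carrier

  rawLattice : RawLattice c ℓ
  rawLattice = record { _≈_ = _≈_; _∧_ = _∧_; _∨_ = _∨_ }

  𝟙[_] : Op₁ Carrier
  𝟙[ x ] = x ∨ ¬ x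

  𝟘[_] : Op₁ Carrier
  𝟘[ x ] = x ∧ ¬ x

  _≥_ : Rel Carrier ℓ
  y ≥ x = x ∧ y ≈ x

  π₁ : Carrier → Pred Carrier ℓ
  π₁ x z = 𝟙[ z ] ≈ 𝟙[ x ]

-- The library's axioms have absorption where X ∨ 0 = X ∧ 1 = X is also
-- customary; given the remaining axioms the two choices are equivalent.
IsBooleanAlgebra : RawBooleanAlgebra c ℓ → Set (c ⊔ ℓ)
IsBooleanAlgebra A = LatticeStructures.IsBooleanAlgebra _≈_ _∨_ _∧_ ¬_ 𝟙 𝟘
  where open RawBooleanAlgebra A

-- Preservation of 𝟘 is deliberately not required.
record IsBooleanHomomorphism
         (A : RawBooleanAlgebra c₁ ℓ₁) (B : RawBooleanAlgebra c₂ ℓ₂)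
         (⟦_⟧ : RawBooleanAlgebra.Carrier A → RawBooleanAlgebra.Carrier B)
         : Set (c₁ ⊔ ℓ₁ ⊔ ℓ₂) where
  private
    module A = RawBooleanAlgebra A
    module B = RawBooleanAlgebra B
  open LatticeMorphisms A.rawLattice B.rawLattice using (IsLatticeHomomorphism)
  field
    isLatticeHomomorphism : IsLatticeHomomorphism ⟦_⟧
    ¬-homo                : ∀ x → ⟦ A.¬ x ⟧ B.≈ B.¬ ⟦ x ⟧
    𝟙-homo                : ⟦ A.𝟙 ⟧ B.≈ B.𝟙

  open IsLatticeHomomorphism isLatticeHomomorphism public

module _ (A : RawBooleanAlgebra c ℓ) where
  open RawBooleanAlgebra A
  open AlgebraDefinitions _≈_

  record IsWeakRelativizedBooleanAlgebra : Set (c ⊔ ℓ) where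
    field
      isEquivalence : IsEquivalence _≈_
      ∧-cong        : Congruent₂ _∧_
      ∨-cong        : Congruent₂ _∨_
      ¬-cong        : Congruent₁ ¬_

      ∧-assoc       : Associative _∧_
      ∨-assoc       : Associative _∨_
      ∧-comm        : Commutative _∧_
      ∨-comm        : Commutative _∨_
      ∧-distrib-∨   : _∧_ DistributesOver _∨_
      ∨-distrib-∧   : _∨_ DistributesOver _∧_
      deMorgan₁     : ∀ x y → ¬ (x ∧ y) ≈ ¬ x ∨ ¬ y
      deMorgan₂     : ∀ x y → ¬ (x ∨ y) ≈ ¬ x ∧ ¬ y

      ∧-idem        : Idempotent _∧_
      ∨-idem        : Idempotent _∨_
      ∧-identityʳ   : RightIdentity 𝟙 _∧_
      ¬-involutive  : Involutive ¬_

      ∨-𝟙           : ∀ x → x ∨ 𝟙 ≈ 𝟙[ x ]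

      ∧-zeroʳ       : RightZero 𝟘 _∧_

    open IsEquivalence isEquivalence public

  record IsRelativizedBooleanAlgebra : Set (c ⊔ ℓ) where
    field
      isWeakRelativizedBooleanAlgebra : IsWeakRelativizedBooleanAlgebra
      ¬-relativize : ∀ x y → x ≥ y → ¬ (x ∧ 𝟙[ y ]) ≈ ¬ x ∧ 𝟙[ y ]

    open IsWeakRelativizedBooleanAlgebra isWeakRelativizedBooleanAlgebra public

  record IsClosed (P : Pred Carrier p) : Set (c ⊔ p) where
    field
      ∧-closed : ∀ {x y} → x ∈ P → y ∈ P → x ∧ y ∈ P
      ∨-closed : ∀ {x y} → x ∈ P → y ∈ P → x ∨ y ∈ P
      ¬-closed : ∀ {x} → x ∈ P → ¬ x ∈ P

  -- Equality ignores the membership proofs, so this is a genuine subset.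
  subalgebra : (P : Pred Carrier p) → IsClosed P →
               (⊥ ⊤ : Σ Carrier P) → RawBooleanAlgebra (c ⊔ p) ℓ
  subalgebra P closed ⊥ ⊤ = record
    { Carrier = Σ Carrier P
    ; _≈_     = _≈_ on proj₁
    ; _∧_     = λ (x , x∈P) (y , y∈P) → x ∧ y , ∧-closed x∈P y∈P
    ; _∨_     = λ (x , x∈P) (y , y∈P) → x ∨ y , ∨-closed x∈P y∈P
    ; ¬_      = λ (x , x∈P) → ¬ x , ¬-closed x∈P
    ; 𝟘       = ⊥
    ; 𝟙       = ⊤
    }
    where open IsClosed closed

record WeakRelativizedBooleanAlgebra c ℓ : Set (suc (c ⊔ ℓ)) where
  field
    rawBooleanAlgebra               : RawBooleanAlgebra c ℓ
    isWeakRelativizedBooleanAlgebra :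
      IsWeakRelativizedBooleanAlgebra rawBooleanAlgebra

  open RawBooleanAlgebra rawBooleanAlgebra public
  open IsWeakRelativizedBooleanAlgebra isWeakRelativizedBooleanAlgebra public

  module _ {x : Carrier} (closed : IsClosed rawBooleanAlgebra (π₁ x)) where
    open IsClosed closed

    𝟘∈π₁ : 𝟘[ x ] ∈ π₁ x
    𝟘∈π₁ = ∧-closed refl (¬-closed refl)

    𝟙∈π₁ : 𝟙[ x ] ∈ π₁ x
    𝟙∈π₁ = ∨-closed refl (¬-closed refl)

    π₁-algebra : RawBooleanAlgebra (c ⊔ ℓ) ℓ
    π₁-algebra = subalgebra rawBooleanAlgebra (π₁ x) closed
                   (𝟘[ x ] , 𝟘∈π₁) (𝟙[ x ] , 𝟙∈π₁)

  h : (x y : Carrier) → Carrier → Carrier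
  h _ y z = z ∧ 𝟙[ y ]

  -- That h x y takes values in π₁ y is part of being a homomorphism.
  IsHomomorphism-h : (∀ x → IsClosed rawBooleanAlgebra (π₁ x)) →
                     (x y : Carrier) → Set (c ⊔ ℓ)
  IsHomomorphism-h closed x y =
    Σ[ maps ∈ (∀ {z} → z ∈ π₁ x → h x y z ∈ π₁ y) ]
      IsBooleanHomomorphism (π₁-algebra (closed x)) (π₁-algebra (closed y))
        (λ (z , z∈π₁) → h x y z , maps z∈π₁)

{-# OPTIONS --safe #-}

-- By RB3, 1_X = X ∨ 1, so X ↦ 1_X commutes with ∧ and ∨ (and with ¬ by
-- symmetry): its fibres π₁(X) are closed.  Since X ∨ (X ∧ Y) = X ∧ 1_Y and
-- X ∧ 1_X = X, absorption holds within each fibre.  The map Z ↦ Z ∧ 1_Y always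
-- sends π₁(X) to π₁(Y) and preserves ∧, ∨ and the top; it preserves ¬ by RB5
-- applied to Z ≥ Z ∧ 1_Y, an element with the same top as Y.
module Submission where

open import Defs
open import Data.Product using (_×_; Σ-syntax; _,_; proj₁; proj₂)
open import Function.Bundles using (_⇔_; mk⇔)
open import Relation.Binary using (Setoid)
open import Relation.Unary using (_∈_)
import Relation.Binary.Reasoning.Setoid as SetoidReasoning

module WeakRelativizedBooleanAlgebraProperties
         {c ℓ} (RB : WeakRelativizedBooleanAlgebra c ℓ) where
  open WeakRelativizedBooleanAlgebra RB

  setoid : Setoid c ℓ
  setoid = record { isEquivalence = isEquivalence }

  open SetoidReasoning setoid

  ∧-congˡ : ∀ {x y z} → y ≈ z → x ∧ y ≈ x ∧ z
  ∧-congˡ = ∧-cong refl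

  ∧-congʳ : ∀ {x y z} → y ≈ z → y ∧ x ≈ z ∧ x
  ∧-congʳ y≈z = ∧-cong y≈z refl

  𝟙-cong : ∀ {x y} → x ≈ y → 𝟙[ x ] ≈ 𝟙[ y ]
  𝟙-cong x≈y = ∨-cong x≈y (¬-cong x≈y)

  𝟙-¬ : ∀ x → 𝟙[ ¬ x ] ≈ 𝟙[ x ]
  𝟙-¬ x = trans (∨-comm (¬ x) (¬ ¬ x)) (∨-cong (¬-involutive x) refl)

  𝟙-∧ : ∀ x y → 𝟙[ x ∧ y ] ≈ 𝟙[ x ] ∧ 𝟙[ y ]
  𝟙-∧ x y = begin
    𝟙[ x ∧ y ]           ≈⟨ ∨-𝟙 (x ∧ y) ⟨
    (x ∧ y) ∨ 𝟙          ≈⟨ proj₂ ∨-distrib-∧ 𝟙 x y ⟩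
    (x ∨ 𝟙) ∧ (y ∨ 𝟙)    ≈⟨ ∧-cong (∨-𝟙 x) (∨-𝟙 y) ⟩
    𝟙[ x ] ∧ 𝟙[ y ]      ∎

  𝟙-∨ : ∀ x y → 𝟙[ x ∨ y ] ≈ 𝟙[ x ] ∨ 𝟙[ y ]
  𝟙-∨ x y = begin
    𝟙[ x ∨ y ]           ≈⟨ ∨-𝟙 (x ∨ y) ⟨
    -- Idempotence doubles `𝟙`, so that `x` and `y` can each be paired with a copy of their own.
    (x ∨ y) ∨ 𝟙          ≈⟨ ∨-cong refl (∨-idem 𝟙) ⟨
    (x ∨ y) ∨ (𝟙 ∨ 𝟙)    ≈⟨ ∨-assoc x y (𝟙 ∨ 𝟙) ⟩
    x ∨ (y ∨ (𝟙 ∨ 𝟙))    ≈⟨ ∨-cong refl (∨-assoc y 𝟙 𝟙) ⟨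
    x ∨ ((y ∨ 𝟙) ∨ 𝟙)    ≈⟨ ∨-cong refl (∨-comm (y ∨ 𝟙) 𝟙) ⟩
    x ∨ (𝟙 ∨ (y ∨ 𝟙))    ≈⟨ ∨-assoc x 𝟙 (y ∨ 𝟙) ⟨
    (x ∨ 𝟙) ∨ (y ∨ 𝟙)    ≈⟨ ∨-cong (∨-𝟙 x) (∨-𝟙 y) ⟩
    𝟙[ x ] ∨ 𝟙[ y ]      ∎

  𝟙-idem : ∀ x → 𝟙[ 𝟙[ x ] ] ≈ 𝟙[ x ]
  𝟙-idem x = begin
    𝟙[ x ∨ ¬ x ]         ≈⟨ 𝟙-∨ x (¬ x) ⟩
    𝟙[ x ] ∨ 𝟙[ ¬ x ]    ≈⟨ ∨-cong refl (𝟙-¬ x) ⟩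
    𝟙[ x ] ∨ 𝟙[ x ]      ≈⟨ ∨-idem 𝟙[ x ] ⟩
    𝟙[ x ]               ∎

  -- Makes the bottom a function of the top, so that all elements of one fibre share a single
  -- bottom.
  𝟘≈¬𝟙 : ∀ x → 𝟘[ x ] ≈ ¬ 𝟙[ x ]
  𝟘≈¬𝟙 x = begin
    x ∧ ¬ x              ≈⟨ ∧-comm x (¬ x) ⟩
    ¬ x ∧ x              ≈⟨ ∧-congˡ (¬-involutive x) ⟨
    ¬ x ∧ ¬ ¬ x          ≈⟨ deMorgan₂ x (¬ x) ⟨
    ¬ (x ∨ ¬ x)          ∎

  -- Measures how far absorption can fail outside a fibre: once `x` is written as `x ∧ 𝟙`,
  -- distributivity factors `x` out and leaves `y ∨ 𝟙`, which RB3 evaluates.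
  x∨x∧y≈x∧𝟙[y] : ∀ x y → x ∨ x ∧ y ≈ x ∧ 𝟙[ y ]
  x∨x∧y≈x∧𝟙[y] x y = begin
    x ∨ (x ∧ y)          ≈⟨ ∨-cong (∧-identityʳ x) refl ⟨
    (x ∧ 𝟙) ∨ (x ∧ y)    ≈⟨ ∨-comm (x ∧ 𝟙) (x ∧ y) ⟩
    (x ∧ y) ∨ (x ∧ 𝟙)    ≈⟨ proj₁ ∧-distrib-∨ x y 𝟙 ⟨
    x ∧ (y ∨ 𝟙)          ≈⟨ ∧-congˡ (∨-𝟙 y) ⟩
    x ∧ 𝟙[ y ]           ∎

  x∧𝟙[x]≈x : ∀ x → x ∧ 𝟙[ x ] ≈ x
  x∧𝟙[x]≈x x = begin
    x ∧ 𝟙[ x ]           ≈⟨ x∨x∧y≈x∧𝟙[y] x x ⟨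
    x ∨ (x ∧ x)          ≈⟨ ∨-cong refl (∧-idem x) ⟩
    x ∨ x                ≈⟨ ∨-idem x ⟩
    x                    ∎

  -- A shared top turns the error factor `𝟙[ y ]` into `𝟙[ x ]`, which acts as a unit on `x`.
  ∨-absorbs-∧-in-fibre : ∀ {x y} → 𝟙[ y ] ≈ 𝟙[ x ] → x ∨ x ∧ y ≈ x
  ∨-absorbs-∧-in-fibre {x} {y} 𝟙y≈𝟙x = begin
    x ∨ (x ∧ y)          ≈⟨ x∨x∧y≈x∧𝟙[y] x y ⟩
    x ∧ 𝟙[ y ]           ≈⟨ ∧-congˡ 𝟙y≈𝟙x ⟩
    x ∧ 𝟙[ x ]           ≈⟨ x∧𝟙[x]≈x x ⟩
    x                    ∎

  ∧-absorbs-∨-in-fibre : ∀ {x y} → 𝟙[ y ] ≈ 𝟙[ x ] → x ∧ (x ∨ y) ≈ x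
  ∧-absorbs-∨-in-fibre {x} {y} 𝟙y≈𝟙x = begin
    x ∧ (x ∨ y)          ≈⟨ proj₁ ∧-distrib-∨ x x y ⟩
    (x ∧ x) ∨ (x ∧ y)    ≈⟨ ∨-cong (∧-idem x) refl ⟩
    x ∨ (x ∧ y)          ≈⟨ ∨-absorbs-∧-in-fibre 𝟙y≈𝟙x ⟩
    x                    ∎

  π₁-closed : ∀ x → IsClosed rawBooleanAlgebra (π₁ x)
  π₁-closed x = record
    { ∧-closed = λ {y} {z} y∈ z∈ →
        trans (𝟙-∧ y z) (trans (∧-cong y∈ z∈) (∧-idem 𝟙[ x ]))
    ; ∨-closed = λ {y} {z} y∈ z∈ →
        trans (𝟙-∨ y z) (trans (∨-cong y∈ z∈) (∨-idem 𝟙[ x ]))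
    ; ¬-closed = λ {y} y∈ → trans (𝟙-¬ y) y∈
    }

  ∧-complement-in-fibre : ∀ {x z} → z ∈ π₁ x → z ∧ ¬ z ≈ 𝟘[ x ]
  ∧-complement-in-fibre {x} {z} z∈ =
    trans (𝟘≈¬𝟙 z) (trans (¬-cong z∈) (sym (𝟘≈¬𝟙 x)))

  π₁-isBooleanAlgebra : ∀ x → IsBooleanAlgebra (π₁-algebra (π₁-closed x))
  π₁-isBooleanAlgebra x = record
    { isDistributiveLattice = record
      { isLattice = record
        { isEquivalence = record { refl = refl ; sym = sym ; trans = trans }
        ; ∨-comm        = λ (y , _) (z , _) → ∨-comm y z
        ; ∨-assoc       = λ (u , _) (v , _) (w , _) → ∨-assoc u v w
        ; ∨-cong        = ∨-cong
        ; ∧-comm        = λ (y , _) (z , _) → ∧-comm y z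
        ; ∧-assoc       = λ (u , _) (v , _) (w , _) → ∧-assoc u v w
        ; ∧-cong        = ∧-cong
        ; absorptive    =
            (λ (y , y∈) (z , z∈) → ∨-absorbs-∧-in-fibre (trans z∈ (sym y∈)))
          , (λ (y , y∈) (z , z∈) → ∧-absorbs-∨-in-fibre (trans z∈ (sym y∈)))
        }
      ; ∨-distrib-∧ =
          (λ (u , _) (v , _) (w , _) → proj₁ ∨-distrib-∧ u v w)
        , (λ (u , _) (v , _) (w , _) → proj₂ ∨-distrib-∧ u v w)
      ; ∧-distrib-∨ =
          (λ (u , _) (v , _) (w , _) → proj₁ ∧-distrib-∨ u v w)
        , (λ (u , _) (v , _) (w , _) → proj₂ ∧-distrib-∨ u v w)
      }
    -- Membership of `y` in the fibre unfolds to `y ∨ ¬ y ≈ 𝟙[ x ]`, which is already the complement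
    -- law.
    ; ∨-complement =
        (λ (y , y∈) → trans (∨-comm (¬ y) y) y∈)
      , (λ (y , y∈) → y∈)
    ; ∧-complement =
        (λ (y , y∈) → trans (∧-comm (¬ y) y) (∧-complement-in-fibre y∈))
      , (λ (y , y∈) → ∧-complement-in-fibre y∈)
    ; ¬-cong = ¬-cong
    }

  -- Because `𝟙[_]` commutes with `∧`, it can be applied to both sides of `y ∧ x ≈ y`.
  𝟙-monotone : ∀ {x y} → x ≥ y → 𝟙[ x ] ∧ 𝟙[ y ] ≈ 𝟙[ y ]
  𝟙-monotone {x} {y} x≥y = begin
    𝟙[ x ] ∧ 𝟙[ y ]      ≈⟨ ∧-comm 𝟙[ x ] 𝟙[ y ] ⟩
    𝟙[ y ] ∧ 𝟙[ x ]      ≈⟨ 𝟙-∧ y x ⟨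
    𝟙[ y ∧ x ]           ≈⟨ 𝟙-cong x≥y ⟩
    𝟙[ y ]               ∎

  h-maps : ∀ {x y} → x ≥ y → ∀ {z} → z ∈ π₁ x → h x y z ∈ π₁ y
  h-maps {x} {y} x≥y {z} z∈ = begin
    𝟙[ z ∧ 𝟙[ y ] ]      ≈⟨ 𝟙-∧ z 𝟙[ y ] ⟩
    𝟙[ z ] ∧ 𝟙[ 𝟙[ y ] ] ≈⟨ ∧-cong z∈ (𝟙-idem y) ⟩
    𝟙[ x ] ∧ 𝟙[ y ]      ≈⟨ 𝟙-monotone x≥y ⟩
    𝟙[ y ]               ∎

  -- Idempotence supplies a second copy of `t`, one for each factor.
  ∧-distribʳ-∧ : ∀ t u v → (u ∧ v) ∧ t ≈ (u ∧ t) ∧ (v ∧ t)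
  ∧-distribʳ-∧ t u v = begin
    (u ∧ v) ∧ t          ≈⟨ ∧-congˡ (∧-idem t) ⟨
    (u ∧ v) ∧ (t ∧ t)    ≈⟨ ∧-assoc u v (t ∧ t) ⟩
    u ∧ (v ∧ (t ∧ t))    ≈⟨ ∧-congˡ (∧-assoc v t t) ⟨
    u ∧ ((v ∧ t) ∧ t)    ≈⟨ ∧-congˡ (∧-comm (v ∧ t) t) ⟩
    u ∧ (t ∧ (v ∧ t))    ≈⟨ ∧-assoc u t (v ∧ t) ⟨
    (u ∧ t) ∧ (v ∧ t)    ∎

  z≥z∧t : ∀ z t → z ≥ z ∧ t
  z≥z∧t z t = begin
    (z ∧ t) ∧ z          ≈⟨ ∧-comm (z ∧ t) z ⟩
    z ∧ (z ∧ t)          ≈⟨ ∧-assoc z z t ⟨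
    (z ∧ z) ∧ t          ≈⟨ ∧-congʳ (∧-idem z) ⟩
    z ∧ t                ∎

  h-¬-homo : IsRelativizedBooleanAlgebra rawBooleanAlgebra →
             ∀ {x y} → x ≥ y → ∀ {z} → z ∈ π₁ x →
             h x y (¬ z) ≈ ¬ h x y z
  h-¬-homo isRBA {x} {y} x≥y {z} z∈ = begin
    ¬ z ∧ 𝟙[ y ]             ≈⟨ ∧-congˡ (h-maps x≥y z∈) ⟨
    ¬ z ∧ 𝟙[ z ∧ 𝟙[ y ] ]    ≈⟨ ¬-relativize z (z ∧ 𝟙[ y ]) (z≥z∧t z 𝟙[ y ]) ⟨
    ¬ (z ∧ 𝟙[ z ∧ 𝟙[ y ] ])  ≈⟨ ¬-cong (∧-congˡ (h-maps x≥y z∈)) ⟩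
    ¬ (z ∧ 𝟙[ y ])           ∎
    where open IsRelativizedBooleanAlgebra isRBA using (¬-relativize)

  h-isHomomorphism : IsRelativizedBooleanAlgebra rawBooleanAlgebra →
                     ∀ x y → x ≥ y → IsHomomorphism-h π₁-closed x y
  h-isHomomorphism isRBA x y x≥y = h-maps x≥y , record
    { isLatticeHomomorphism = record
      { isRelHomomorphism = record { cong = ∧-congʳ }
      ; ∧-homo = λ (u , _) (v , _) → ∧-distribʳ-∧ 𝟙[ y ] u v
      ; ∨-homo = λ (u , _) (v , _) → proj₂ ∧-distrib-∨ 𝟙[ y ] u v
      }
    ; ¬-homo = λ (z , z∈) → h-¬-homo isRBA x≥y z∈
    -- The top of the source is `𝟙[ x ]`, and its image is `𝟙[ x ] ∧ 𝟙[ y ]`.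
    ; 𝟙-homo = 𝟙-monotone x≥y
    }

  -- Each `x` lies in its own fibre by reflexivity, and preservation of `¬` at that point is RB5
  -- read from right to left.
  h-isHomomorphism⇒isRelativized :
    (∀ x y → x ≥ y → IsHomomorphism-h π₁-closed x y) →
    IsRelativizedBooleanAlgebra rawBooleanAlgebra
  h-isHomomorphism⇒isRelativized hom = record
    { isWeakRelativizedBooleanAlgebra = isWeakRelativizedBooleanAlgebra
    ; ¬-relativize = λ x y x≥y →
        sym (IsBooleanHomomorphism.¬-homo (proj₂ (hom x y x≥y)) (x , refl))
    }

  -- Associativity merges the two relativizations into one meet of tops, which collapses to the
  -- smaller top.
  h-∘ : ∀ x {y z} → y ≥ z → ∀ w → h y z (h x y w) ≈ h x z w
  h-∘ x {y} {z} y≥z w = begin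
    (w ∧ 𝟙[ y ]) ∧ 𝟙[ z ]    ≈⟨ ∧-assoc w 𝟙[ y ] 𝟙[ z ] ⟩
    w ∧ (𝟙[ y ] ∧ 𝟙[ z ])    ≈⟨ ∧-congˡ (𝟙-monotone y≥z) ⟩
    w ∧ 𝟙[ z ]               ∎

theorem1 : ∀ {c ℓ} (RB : WeakRelativizedBooleanAlgebra c ℓ) →
    let open WeakRelativizedBooleanAlgebra RB in
    Σ[ closed ∈ (∀ X → IsClosed rawBooleanAlgebra (π₁ X)) ]
    ( (∀ X → IsBooleanAlgebra (π₁-algebra (closed X)))
    × (IsRelativizedBooleanAlgebra rawBooleanAlgebra ⇔
    (∀ X Y → X ≥ Y → IsHomomorphism-h closed X Y))
    × (IsRelativizedBooleanAlgebra rawBooleanAlgebra →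
    ∀ X Y Z → X ≥ Y → Y ≥ Z →
    ∀ W → W ∈ π₁ X → h Y Z (h X Y W) ≈ h X Z W) )
theorem1 RB =
    π₁-closed
  , π₁-isBooleanAlgebra
  , mk⇔ h-isHomomorphism h-isHomomorphism⇒isRelativized
  , λ _ X _ _ _ Y≥Z W _ → h-∘ X Y≥Z W
  where open WeakRelativizedBooleanAlgebraProperties RB
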